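{- Let $K$ be a $k$-dimensional USO and $h\in[k]$ some dimension. Let $U\subset\{0,1\}^k$ be the set of vertices in the upper $h$-facet that are incident to an upwards $h$-edge of $K$, and let $L=\{v\oplus h: v\in U\}$ be the set of their neighbors in the lower $h$-facet. Let $K_U$ and $K_L$ be the (oriented) subgraphs induced by $U$ and by $L$, respectively. Then swapping these two subgraphs yields an orientation $K'$ of $Q_k$, and $K'$ is a USO. Here swapping means that $K'$ is the function given by $$K'(v)=\begin{cases}K(v\oplus h) & \text{if } v\in U\cup L,\\ K(v)&\text{otherwise.}\end{cases}$$
   Context: $[k]=\{1,\ldots,k\}$. $Q_k$ is the $k$-dimensional hypercube graph with vertex set $\{0,1\}^k$; $v\oplus i$ denotes the neighbor of $v$ differing from $v$ exactly in coordinate $i$, and $\{v,v\oplus i\}$ is called an $i$-edge. The upper (lower) $h$-facet is the subgraph induced by the vertices $v$ with $v_h=1$ ($v_h=0$). An orientation $O$ of $Q_k$ directs every edge; it is identified with the function $O:\{0,1\}^k\to\{0,1\}^k$ where $O(v)_i=1$ if the edge $\{v,v\oplus i\}$ is directed upwards (from its endpoint in the lower $i$-facet to its endpoint in the upper $i$-facet) and $O(v)_i=0$ if it is directed downwards. Thus a function $O:\{0,1\}^k\to\{0,1\}^k$ is an orientation if and only if $O(v)_i=O(v\oplus i)_i$ for all $v$ and $i$. A face is the subgraph induced by all vertices that agree with a fixed string $f\in\{0,1,*\}^k$ on the non-$*$ positions. $O$ is a Unique Sink Orientation (USO) if every face contains exactly one vertex with no outgoing edges inside that face. The operation taking $K$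 to $K'$ is called a partial swap in dimension $h$. -}

module Defs where

open import Data.Bool.Base using (Bool; true; false; not; if_then_else_)
open import Data.Bool.Properties using (not-involutive) renaming (_≟_ to _≟ᵇ_)
open import Data.Fin.Base using (Fin)
open import Data.Maybe.Base using (Maybe; just)
open import Data.Nat.Base using (ℕ)
open import Data.Product using (∃; ∃!; _×_; _,_)
open import Data.Sum.Base using (_⊎_)
open import Data.Vec.Base using (Vec; lookup; updateAt)
open import Data.Vec.Properties using (updateAt-updateAt; updateAt-id-local)
open import Level using (0ℓ)
open import Relation.Binary.PropositionalEquality using (_≡_; refl; sym; trans; subst)
open import Relation.Nullary.Decidable using (does; map′; _×-dec_)
open import Relation.Nullary.Negation using (¬_)
open import Relation.Unary using (Pred; Decidable)
open import Relation.Unary.Properties using (_∪?_)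

private
  variable
    k : ℕ

-- The coordinate value 1 is `true` and 0 is `false`.
Vertex : ℕ → Set
Vertex k = Vec Bool k

infixl 6 _⊕_

_⊕_ : Vertex k → Fin k → Vertex k
v ⊕ i = updateAt v i not

⊕-involutive : (v : Vertex k) (i : Fin k) → (v ⊕ i) ⊕ i ≡ v
⊕-involutive v i = trans (updateAt-updateAt i v)
                         (updateAt-id-local i v (not-involutive (lookup v i)))

CubeMap : ℕ → Set
CubeMap k = Vertex k → Vertex k

IsOrientation : CubeMap k → Set
IsOrientation {k} O = (v : Vertex k) (i : Fin k) → lookup (O v) i ≡ lookup (O (v ⊕ i)) i

UpwardEdge DownwardEdge : CubeMap k → Vertex k → Fin k → Set
UpwardEdge   O v i = lookup (O v) i ≡ true
DownwardEdge O v i = lookup (O v) i ≡ false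

UpperFacet LowerFacet : Fin k → Pred (Vertex k) 0ℓ
UpperFacet i v = lookup v i ≡ true
LowerFacet i v = lookup v i ≡ false

-- O(v) records the direction of the edges at v relative to the cube (up or
-- down), not relative to v, so being outgoing also depends on the side of v.
Outgoing : CubeMap k → Vertex k → Fin k → Set
Outgoing O v i = (LowerFacet i v × UpwardEdge O v i) ⊎ (UpperFacet i v × DownwardEdge O v i)

-- A string over {0,1,*}, with `nothing` in the role of *.
Face : ℕ → Set
Face k = Vec (Maybe Bool) k

infix 4 _∈ᶠ_

_∈ᶠ_ : Vertex k → Face k → Set
_∈ᶠ_ {k} v f = (i : Fin k) (b : Bool) → lookup f i ≡ just b → lookup v i ≡ b

-- Faces are induced subgraphs, so the i-edge at v ∈ᶠ f lies in f exactly when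
-- v ⊕ i ∈ᶠ f.
IsSinkOf : CubeMap k → Face k → Vertex k → Set
IsSinkOf {k} O f v = v ∈ᶠ f × ((i : Fin k) → v ⊕ i ∈ᶠ f → ¬ Outgoing O v i)

IsUSO : CubeMap k → Set
IsUSO {k} O = IsOrientation O × ((f : Face k) → ∃! _≡_ (IsSinkOf O f))

module _ (K : CubeMap k) (h : Fin k) where

  U : Pred (Vertex k) 0ℓ
  U v = UpperFacet h v × UpwardEdge K v h

  L : Pred (Vertex k) 0ℓ
  L w = ∃ λ v → U v × w ≡ v ⊕ h

  U? : Decidable U
  U? v = (lookup v h ≟ᵇ true) ×-dec (lookup (K v) h ≟ᵇ true)

  L? : Decidable L
  L? w = map′ (λ u → w ⊕ h , u , sym (⊕-involutive w h))
              (λ { (v , u , refl) → subst U (sym (⊕-involutive v h)) u })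
              (U? (w ⊕ h))

  partialSwap : CubeMap k
  partialSwap v = if does ((U? ∪? L?) v) then K (v ⊕ h) else K v

{-# OPTIONS --safe #-}

-- Call two vertices separated by O if O agrees on some coordinate in which they
-- differ.  By Szabó and Welzl, an orientation is a USO iff it separates every
-- pair of distinct vertices.  The vertices moved by the partial swap are those
-- with K(v)_h = 1.  If both or neither of v and w are moved, K′ separates them
-- because K does.  If only v is moved, K separates v ⊕ h and w in a coordinate
-- that cannot be h, since K(v ⊕ h)_h = 1 and K(w)_h = 0.
module Submission where

open import Defs
open import Data.Bool.Base using (Bool; true; false; not; if_then_else_)
open import Data.Bool.Properties using (not-¬; ¬-not) renaming (_≟_ to _≟ᵇ_)
open import Data.Empty using (⊥; ⊥-elim)
open import Data.Fin.Base using (Fin)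
open import Data.Fin.Properties using (_≟_; any?)
open import Data.List.Base using (List; []; _∷_; allFin)
open import Data.List.Membership.Propositional using (_∈_)
open import Data.List.Membership.Propositional.Properties using (∈-allFin)
open import Data.List.Relation.Unary.Any using (here; there)
open import Data.Maybe.Base using (Maybe; just; nothing; fromMaybe)
open import Data.Maybe.Properties using (just-injective)
open import Data.Nat.Base using (ℕ)
open import Data.Product.Base using (_×_; _,_; proj₁; proj₂; ∃)
open import Data.Sum.Base using (inj₁; inj₂)
open import Data.Vec.Base using (lookup; map; zipWith; _[_]≔_)
open import Data.Vec.Properties using (lookup∘updateAt; lookup∘updateAt′; updateAt-commutes;
  lookup∘update; lookup∘update′; lookup-map; lookup-zipWith; ≡-dec)
open import Function.Base using (_∘_)
open import Relation.Binary.PropositionalEquality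
  using (_≡_; _≢_; refl; sym; trans; cong; subst; ≢-sym)
open import Relation.Nullary.Decidable using (yes; no; ¬?; _×-dec_; decidable-stable)
open import Relation.Nullary.Negation using (¬_; contradiction)

private
  variable
    k : ℕ
    O K : CubeMap k
    f : Face k
    v w : Vertex k

-- Coordinates of neighbours and directions of edges.

≢-≢⇒≡ : {a b c : Bool} → a ≢ c → b ≢ c → a ≡ b
≢-≢⇒≡ a≢c b≢c = trans (¬-not a≢c) (sym (¬-not b≢c))

⊕-differs : (v : Vertex k) (i : Fin k) → lookup (v ⊕ i) i ≢ lookup v i
⊕-differs v i eq = not-¬ refl (trans (sym eq) (lookup∘updateAt i v))

lookup-⊕-≢ : {i j : Fin k} (v : Vertex k) → j ≢ i → lookup (v ⊕ i) j ≡ lookup v j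
lookup-⊕-≢ {i = i} {j} v j≢i = lookup∘updateAt′ j i j≢i v

⊕-commutes : {h i : Fin k} (v : Vertex k) → i ≢ h → v ⊕ i ⊕ h ≡ v ⊕ h ⊕ i
⊕-commutes {h = h} {i} v i≢h = updateAt-commutes h i (≢-sym i≢h) v

⊕-agree : {i j : Fin k} (v w : Vertex k) →
          lookup v j ≡ lookup w j → lookup (v ⊕ i) j ≡ lookup (w ⊕ i) j
⊕-agree {i = i} {j} v w eq with j ≟ i
... | yes refl = trans (lookup∘updateAt i v) (trans (cong not eq) (sym (lookup∘updateAt i w)))
... | no j≢i   = trans (lookup-⊕-≢ v j≢i) (trans eq (sym (lookup-⊕-≢ w j≢i)))

⊕-agree⁻ : {i j : Fin k} (v w : Vertex k) →
           lookup (v ⊕ i) j ≡ lookup (w ⊕ i) j → lookup v j ≡ lookup w j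
⊕-agree⁻ {i = i} v w eq with ⊕-agree {i = i} (v ⊕ i) (w ⊕ i) eq
... | eq′ rewrite ⊕-involutive v i | ⊕-involutive w i = eq′

-- The i-edge at v is outgoing exactly when O(v)_i differs from v_i.
Settled : CubeMap k → Vertex k → Fin k → Set
Settled O v i = lookup v i ≡ lookup (O v) i

settled⇒¬outgoing : (O : CubeMap k) (v : Vertex k) (i : Fin k) → Settled O v i → ¬ Outgoing O v i
settled⇒¬outgoing O v i s (inj₁ (lo , up)) = contradiction (trans (sym lo) (trans s up)) λ ()
settled⇒¬outgoing O v i s (inj₂ (up , lo)) = contradiction (trans (sym up) (trans s lo)) λ ()

¬outgoing⇒settled : (O : CubeMap k) (v : Vertex k) (i : Fin k) → ¬ Outgoing O v i → Settled O v i
¬outgoing⇒settled O v i ¬out with lookup v i | lookup (O v) i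
... | false | false = refl
... | false | true  = contradiction (inj₁ (refl , refl)) ¬out
... | true  | false = contradiction (inj₂ (refl , refl)) ¬out
... | true  | true  = refl

-- Faces and their sinks.

Free : Face k → Fin k → Set
Free f i = lookup f i ≡ nothing

free⇒⊕∈ : (f : Face k) (v : Vertex k) (i : Fin k) → v ∈ᶠ f → Free f i → v ⊕ i ∈ᶠ f
free⇒⊕∈ f v i v∈f free j b eq with j ≟ i
... | yes refl = contradiction (trans (sym eq) free) λ ()
... | no j≢i   = trans (lookup-⊕-≢ v j≢i) (v∈f j b eq)

differ⇒free : (f : Face k) (v w : Vertex k) {i : Fin k} →
              v ∈ᶠ f → w ∈ᶠ f → lookup v i ≢ lookup w i → Free f i
differ⇒free f v w {i} v∈f w∈f v≢w with lookup f i in eq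
... | nothing = refl
... | just b  = contradiction (trans (v∈f i b eq) (sym (w∈f i b eq))) v≢w

-- A positive form of `IsSinkOf`: one equation per free coordinate replaces neighbours in the face
-- and negated outgoing edges.
record Sink (O : CubeMap k) (f : Face k) (v : Vertex k) : Set where
  constructor mkSink
  field
    member  : v ∈ᶠ f
    settled : ∀ i → Free f i → Settled O v i

open Sink

sink⇒isSinkOf : Sink O f v → IsSinkOf O f v
sink⇒isSinkOf {O = O} {f = f} {v = v} (mkSink v∈f s) = v∈f , λ i v⊕i∈f →
  settled⇒¬outgoing O v i (s i (differ⇒free f (v ⊕ i) v v⊕i∈f v∈f (⊕-differs v i)))

isSinkOf⇒sink : IsSinkOf O f v → Sink O f v
isSinkOf⇒sink {O = O} {f = f} {v = v} (v∈f , s) = mkSink v∈f λ i free →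
  ¬outgoing⇒settled O v i (s i (free⇒⊕∈ f v i v∈f free))

record HasUniqueSinks (O : CubeMap k) : Set where
  field
    sink   : (f : Face k) → ∃ (Sink O f)
    unique : Sink O f v → Sink O f w → v ≡ w

open HasUniqueSinks

isUSO⇒hasUniqueSinks : IsUSO O → HasUniqueSinks O
isUSO⇒hasUniqueSinks {O = O} (_ , uso) = record
  { sink   = λ f → let (s , sink-s , _) = uso f in s , isSinkOf⇒sink sink-s
  ; unique = λ {f} a b → let (_ , _ , ≡sink) = uso f in
      trans (sym (≡sink (sink⇒isSinkOf a))) (≡sink (sink⇒isSinkOf b))
  }

hasUniqueSinks⇒isUSO : IsOrientation O → HasUniqueSinks O → IsUSO O
hasUniqueSinks⇒isUSO ori uso = ori , λ f →
  let (s , sink-s) = sink uso f in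
  s , sink⇒isSinkOf sink-s , λ sink′ → unique uso sink-s (isSinkOf⇒sink sink′)

-- Facets of a face `f`, encoded as `f [ h ]≔ just c` with `h` free in `f`.

facet⊆ : (f : Face k) (h : Fin k) (v : Vertex k) {c : Bool} →
         Free f h → v ∈ᶠ f [ h ]≔ just c → v ∈ᶠ f
facet⊆ f h v free v∈ i b eq with i ≟ h
... | yes refl = contradiction (trans (sym free) eq) λ ()
... | no i≢h   = v∈ i b (trans (lookup∘update′ i≢h f _) eq)

facet-coordinate : {h : Fin k} {c : Bool} → Sink O (f [ h ]≔ just c) v → lookup v h ≡ c
facet-coordinate {f = f} {h = h} sink-v = member sink-v h _ (lookup∘update h f _)

free-facet⁺ : {h i : Fin k} {c : Bool} (f : Face k) → i ≢ h → Free f i → Free (f [ h ]≔ just c) i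
free-facet⁺ f i≢h free = trans (lookup∘update′ i≢h f _) free

free-facet⁻ : (f : Face k) (h i : Fin k) {c : Bool} → Free (f [ h ]≔ just c) i → i ≢ h × Free f i
free-facet⁻ f h i free with i ≟ h
... | yes refl = contradiction (trans (sym (lookup∘update h f _)) free) λ ()
... | no i≢h   = i≢h , trans (sym (lookup∘update′ i≢h f _)) free

facet-¬free : (f : Face k) (h : Fin k) {c : Bool} → ¬ Free (f [ h ]≔ just c) h
facet-¬free f h free = proj₁ (free-facet⁻ f h h free) refl

sink-facet⁺ : (h : Fin k) {c : Bool} → lookup v h ≡ c → Sink O f v → Sink O (f [ h ]≔ just c) v
sink-facet⁺ {v = v} {f = f} h {c} vh (mkSink v∈f s) =
  mkSink v∈ λ i free → s i (proj₂ (free-facet⁻ f h i free))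
  where
  v∈ : v ∈ᶠ f [ h ]≔ just c
  v∈ i b eq with i ≟ h
  ... | yes refl = trans vh (just-injective (trans (sym (lookup∘update h f _)) eq))
  ... | no i≢h   = v∈f i b (trans (sym (lookup∘update′ i≢h f _)) eq)

-- Passing from the facet to the face adds only the `h`-edge at `v`.
sink-facet⁻ : {h : Fin k} {c : Bool} → Free f h → Sink O (f [ h ]≔ just c) v → Settled O v h →
              Sink O f v
sink-facet⁻ {f = f} {O = O} {v = v} {h = h} free (mkSink v∈ s) sh =
  mkSink (facet⊆ f h v free v∈) settles
  where
  settles : ∀ i → Free f i → Settled O v i
  settles i fi with i ≟ h
  ... | yes refl = sh
  ... | no i≢h   = s i (free-facet⁺ f i≢h fi)

-- Reversal of all edges of one dimension.

flip : Fin k → CubeMap k → CubeMap k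
flip h O v = O v ⊕ h

flip-settled⁺ : (O : CubeMap k) {h i : Fin k} → i ≢ h → Settled O v i → Settled (flip h O) v i
flip-settled⁺ {v = v} O i≢h s = trans s (sym (lookup-⊕-≢ (O v) i≢h))

flip-settled⁻ : (O : CubeMap k) {h i : Fin k} → i ≢ h → Settled (flip h O) v i → Settled O v i
flip-settled⁻ {v = v} O i≢h s = trans s (lookup-⊕-≢ (O v) i≢h)

flip-unsettles : (O : CubeMap k) (v : Vertex k) {h : Fin k} →
                 Settled O v h → ¬ Settled (flip h O) v h
flip-unsettles O v {h} s s′ = ⊕-differs (O v) h (trans (sym s′) s)

flip-settles : (O : CubeMap k) (v : Vertex k) {h : Fin k} →
               ¬ Settled O v h → Settled (flip h O) v h
flip-settles O v {h} ¬s = ≢-≢⇒≡ ¬s (⊕-differs (O v) h)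

-- A face in which `h` is fixed contains no `h`-edges, so the reversal does not affect it.
flip-sink⁺ : {h : Fin k} → ¬ Free f h → Sink O f v → Sink (flip h O) f v
flip-sink⁺ {O = O} ¬free (mkSink v∈f s) = mkSink v∈f λ i fi →
  flip-settled⁺ O (λ { refl → ¬free fi }) (s i fi)

flip-sink⁻ : {h : Fin k} → ¬ Free f h → Sink (flip h O) f v → Sink O f v
flip-sink⁻ {O = O} ¬free (mkSink v∈f s) = mkSink v∈f λ i fi →
  flip-settled⁻ O (λ { refl → ¬free fi }) (s i fi)

-- The sink of a face is the sink of one of its two h-facets; flipping the
-- h-edges turns the sink of the other h-facet into the sink of the face.
flip-uniqueSink : (h : Fin k) → HasUniqueSinks O → (f : Face k) →
                  ∃ λ t → Sink (flip h O) f t × (∀ {x} → Sink (flip h O) f x → x ≡ t)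
flip-uniqueSink {O = O} h uso f with lookup f h in fh
... | just b =
  let (s , sink-s) = sink uso f in
  s , flip-sink⁺ ¬free sink-s , λ sink-x → unique uso (flip-sink⁻ ¬free sink-x) sink-s
  where
  ¬free : ¬ Free f h
  ¬free free = contradiction (trans (sym fh) free) λ ()
... | nothing = t , sink-t , unique-t
  where
  s  = proj₁ (sink uso f)
  c  = lookup s h
  f′ = f [ h ]≔ just (not c)
  t  = proj₁ (sink uso f′)

  sink-s : Sink O f s
  sink-s = proj₂ (sink uso f)

  t-facet : Sink O f′ t
  t-facet = proj₂ (sink uso f′)

  -- Otherwise `t` would be a sink of the whole face, hence equal to `s`, which lies in the other
  -- facet.
  t-unsettled : ¬ Settled O t h
  t-unsettled th = not-¬
    (cong (λ x → lookup x h) (unique uso (sink-facet⁻ fh t-facet th) sink-s))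
    (facet-coordinate t-facet)

  sink-t : Sink (flip h O) f t
  sink-t = sink-facet⁻ fh (flip-sink⁺ (facet-¬free f h) t-facet) (flip-settles O t t-unsettled)

  restrict : ∀ {x c} → lookup x h ≡ c → Sink (flip h O) f x → Sink O (f [ h ]≔ just c) x
  restrict xh sink-x = flip-sink⁻ (facet-¬free f h) (sink-facet⁺ h xh sink-x)

  unique-t : ∀ {x} → Sink (flip h O) f x → x ≡ t
  unique-t {x} sink-x with lookup x h ≟ᵇ c
  ... | no x≢c  = unique uso (restrict (¬-not x≢c) sink-x) t-facet
  -- On the side of `s` the only candidate is `s` itself, whose `h`-edge has become outgoing.
  ... | yes x≡c = contradiction
    (subst (λ y → Settled (flip h O) y h) x≡s (settled sink-x h fh))
    (flip-unsettles O s (settled sink-s h fh))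
    where
    x≡s : x ≡ s
    x≡s = unique uso (restrict x≡c sink-x) (sink-facet⁺ h refl sink-s)

flip-hasUniqueSinks : (h : Fin k) → HasUniqueSinks O → HasUniqueSinks (flip h O)
flip-hasUniqueSinks h uso = record
  { sink   = λ f → let (t , sink-t , _) = flip-uniqueSink h uso f in t , sink-t
  ; unique = λ {f} a b → let (_ , _ , ≡t) = flip-uniqueSink h uso f in trans (≡t a) (sym (≡t b))
  }

-- Unique sinks imply separation.

-- Since `O` records up or down, agreement at a coordinate where `v` and `w` differ means that
-- exactly one of the two `i`-edges is outgoing.
SeparatedAt : CubeMap k → Vertex k → Vertex k → Fin k → Set
SeparatedAt O v w i = lookup v i ≢ lookup w i × lookup (O v) i ≡ lookup (O w) i

Separating : CubeMap k → Set
Separating {k} O = (v w : Vertex k) → v ≢ w → ∃ (SeparatedAt O v w)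

Unseparated : CubeMap k → Vertex k → Vertex k → Set
Unseparated O v w = ∀ i → ¬ SeparatedAt O v w i

-- Changing both images in the same coordinate preserves where they agree.
flip-unseparated : (O : CubeMap k) (h : Fin k) →
                   Unseparated O v w → Unseparated (flip h O) v w
flip-unseparated {v = v} {w = w} O h un i (v≢w , eq) = un i (v≢w , ⊕-agree⁻ (O v) (O w) eq)

-- Induction on `l`: dimension `h` is reversed only if `v` is unsettled there. Unique sinks and lack
-- of separation survive each reversal.
settle : (l : List (Fin k)) → HasUniqueSinks O → (v w : Vertex k) → Unseparated O v w →
         ∃ λ P → HasUniqueSinks P × Unseparated P v w × (∀ {i} → i ∈ l → Settled P v i)
settle {O = O} [] uso v w un = O , uso , un , λ ()
settle (h ∷ l) uso v w un with settle l uso v w un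
... | P , uso′ , un′ , s with lookup v h ≟ᵇ lookup (P v) h
... | yes sh = P , uso′ , un′ , λ { (here refl) → sh ; (there i∈l) → s i∈l }
... | no ¬sh = flip h P , flip-hasUniqueSinks h uso′ , flip-unseparated P h un′ , s′
  where
  s′ : ∀ {i} → i ∈ h ∷ l → Settled (flip h P) v i
  s′ {i} i∈ with i ≟ h
  s′ i∈          | yes refl = flip-settles P v ¬sh
  s′ (here i≡h)  | no i≢h   = contradiction i≡h i≢h
  s′ (there i∈l) | no i≢h   = flip-settled⁺ P i≢h (s i∈l)

common : Bool → Bool → Maybe Bool
common false false = just false
common true  true  = just true
common _     _     = nothing

common-just : ∀ a b {c} → common a b ≡ just c → a ≡ c × b ≡ c
common-just false false refl = refl , refl
common-just true  true  refl = refl , refl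

common-nothing : ∀ a b → common a b ≡ nothing → a ≢ b
common-nothing false true _ ()
common-nothing true false _ ()

-- The smallest face containing both vertices.
span : Vertex k → Vertex k → Face k
span = zipWith common

∈-spanˡ : (v w : Vertex k) → v ∈ᶠ span v w
∈-spanˡ v w i b eq =
  proj₁ (common-just (lookup v i) (lookup w i) (trans (sym (lookup-zipWith common i v w)) eq))

∈-spanʳ : (v w : Vertex k) → w ∈ᶠ span v w
∈-spanʳ v w i b eq =
  proj₂ (common-just (lookup v i) (lookup w i) (trans (sym (lookup-zipWith common i v w)) eq))

free-span : (v w : Vertex k) (i : Fin k) → Free (span v w) i → lookup v i ≢ lookup w i
free-span v w i free =
  common-nothing (lookup v i) (lookup w i) (trans (sym (lookup-zipWith common i v w)) free)

-- Flip every direction in which v has an outgoing edge: if v and w are not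
-- separated, both become sinks of the face that they span.
unseparated⇒≡ : HasUniqueSinks O → (v w : Vertex k) → Unseparated O v w → v ≡ w
unseparated⇒≡ uso v w un with settle (allFin _) uso v w un
... | P , uso′ , un′ , s =
  unique uso′ {f = span v w}
    (mkSink (∈-spanˡ v w) λ i _ → s (∈-allFin i))
    -- In a free coordinate both `w` and `P w` differ from `v`: the former by the choice of the
    -- face, the latter because `P v` equals `v` there and the pair is unseparated.
    (mkSink (∈-spanʳ v w) λ i free →
      let v≢w = free-span v w i free in
      ≢-≢⇒≡ (≢-sym v≢w)
            (λ eq → un′ i (v≢w , trans (sym (s (∈-allFin i))) (sym eq))))

hasUniqueSinks⇒separating : HasUniqueSinks O → Separating O
hasUniqueSinks⇒separating {O = O} uso v w v≢w =
  -- A search over the finitely many coordinates turns the contrapositive into a witness.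
  decidable-stable
    (any? λ i → ¬? (lookup v i ≟ᵇ lookup w i) ×-dec (lookup (O v) i ≟ᵇ lookup (O w) i))
    (λ none → v≢w (unseparated⇒≡ uso v w λ i sep → none (i , sep)))

-- Separation implies unique sinks.

-- Induction on a list `l` covering the free coordinates. For free `h`, the sink of one of the two
-- `h`-facets is a sink of `f`, as otherwise the two facet sinks would not be separated.
sink-exists : Separating O → (l : List (Fin k)) (f : Face k) →
              (∀ {i} → Free f i → i ∈ l) → ∃ (Sink O f)
sink-exists sep [] f free∈ =
  -- The face is a single vertex here; `false` is only a placeholder.
  map (fromMaybe false) f , mkSink
    (λ i b eq → trans (lookup-map i (fromMaybe false) f) (cong (fromMaybe false) eq))
    (λ i free → contradiction (free∈ free) λ ())
sink-exists {O = O} sep (h ∷ l) f free∈ with lookup f h in fh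
... | just b = sink-exists sep l f free∈l
  where
  free∈l : ∀ {i} → Free f i → i ∈ l
  free∈l free with free∈ free
  ... | here refl = contradiction (trans (sym fh) free) λ ()
  ... | there i∈l = i∈l
... | nothing = choose (facet-sink false) (facet-sink true)
  where
  facet-free∈l : ∀ {c i} → Free (f [ h ]≔ just c) i → i ∈ l
  facet-free∈l {i = i} free with free-facet⁻ f h i free
  ... | i≢h , fi with free∈ fi
  ... | here i≡h  = contradiction i≡h i≢h
  ... | there i∈l = i∈l

  facet-sink : ∀ c → ∃ (Sink O (f [ h ]≔ just c))
  facet-sink c = sink-exists sep l (f [ h ]≔ just c) facet-free∈l

  choose : ∃ (Sink O (f [ h ]≔ just false)) → ∃ (Sink O (f [ h ]≔ just true)) → ∃ (Sink O f)
  choose (s , sink-s) (t , sink-t)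
    with lookup s h ≟ᵇ lookup (O s) h | lookup t h ≟ᵇ lookup (O t) h
  ... | yes sh | _      = s , sink-facet⁻ fh sink-s sh
  ... | no _   | yes th = t , sink-facet⁻ fh sink-t th
  ... | no ¬sh | no ¬th = ⊥-elim (clash (sep s t s≢t))
    where
    s≢t : s ≢ t
    s≢t refl = contradiction (trans (sym (facet-coordinate sink-s)) (facet-coordinate sink-t)) λ ()

    -- At `h` the sinks lie on opposite sides and both are unsettled, so their images differ. At any
    -- other free coordinate both are settled, so equal images force equal coordinates.
    clash : ∃ (SeparatedAt O s t) → ⊥
    clash (i , differ , agree) with i ≟ h
    ... | yes refl = ¬th (≢-≢⇒≡ (≢-sym differ) (λ eq → ¬sh (trans (sym eq) (sym agree))))
    ... | no i≢h   = differ (trans (settled sink-s i (free-facet⁺ f i≢h fi))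
                              (trans agree (sym (settled sink-t i (free-facet⁺ f i≢h fi)))))
      where
      fi : Free f i
      fi = differ⇒free f s t (facet⊆ f h s fh (member sink-s))
                             (facet⊆ f h t fh (member sink-t)) differ

-- A coordinate where two sinks of a face differ is free, so both are settled there and their images
-- differ too.
sink-unique : Separating O → Sink O f v → Sink O f w → v ≡ w
sink-unique {f = f} {v = v} {w = w} sep sink-v sink-w =
  decidable-stable (≡-dec _≟ᵇ_ v w) λ v≢w →
    let (i , differ , agree) = sep v w v≢w
        fi = differ⇒free f v w (member sink-v) (member sink-w) differ
    in differ (trans (settled sink-v i fi) (trans agree (sym (settled sink-w i fi))))

separating⇒hasUniqueSinks : Separating O → HasUniqueSinks O
separating⇒hasUniqueSinks sep = record
  { sink   = λ f → sink-exists sep (allFin _) f (λ {i} _ → ∈-allFin i)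
  ; unique = sink-unique sep
  }

-- The partial swap.

-- `U` and `L` together hold both endpoints of every upward `h`-edge, and these endpoints carry the
-- same `h`-bit of `K`.
partialSwap-if : IsOrientation K → (h : Fin k) (v : Vertex k) →
                 partialSwap K h v ≡ (if lookup (K v) h then K (v ⊕ h) else K v)
partialSwap-if {K = K} ori h v
  rewrite lookup∘updateAt h {not} v | sym (ori v h)
  with lookup v h | lookup (K v) h
... | false | false = refl
... | false | true  = refl
... | true  | false = refl
... | true  | true  = refl

-- In a 2-face whose h-edges point in opposite directions, the i-edges are
-- parallel, as otherwise the face would be a directed cycle.
parallel-edges : {h i : Fin k} → IsOrientation K → Separating K → i ≢ h →
                 lookup (K v) h ≢ lookup (K (v ⊕ i)) h →
                 lookup (K v) i ≡ lookup (K (v ⊕ h)) i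
parallel-edges {K = K} {v = v} {h = h} {i} ori sep i≢h h-edges
  -- These vertices are antipodal in the 2-face, so they are separated at `h` or `i`; the opposite
  -- `h`-edges exclude `h`.
  with sep (v ⊕ i ⊕ h) v (λ eq → ⊕-differs v i
         (trans (sym (lookup-⊕-≢ (v ⊕ i) i≢h)) (cong (λ x → lookup x i) eq)))
... | j , differ , agree with j ≟ h
... | yes refl = contradiction (trans (sym agree) (sym (ori (v ⊕ i) h))) h-edges
... | no j≢h with j ≟ i
... | no j≢i   = contradiction (trans (lookup-⊕-≢ (v ⊕ i) j≢h) (lookup-⊕-≢ v j≢i)) differ
... | yes refl = trans (sym agree) (trans (cong (λ x → lookup (K x) i) (⊕-commutes v i≢h))
                                          (sym (ori (v ⊕ h) i)))

module _ {K : CubeMap k} (ori : IsOrientation K) (sep : Separating K) (h : Fin k) where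

  private
    K′ : CubeMap k
    K′ v = if lookup (K v) h then K (v ⊕ h) else K v

  -- An `h`-edge keeps its direction. For another `i`-edge, if both ends move or both stay, its new
  -- direction is that of an `i`-edge of `K`; if only one end moves, the two `h`-edges are opposite
  -- and `parallel-edges` applies.
  swap-isOrientation : IsOrientation K′
  swap-isOrientation v i with i ≟ h
  ... | yes refl = trans (same-h v) (trans (ori v h) (sym (same-h (v ⊕ h))))
    where
    same-h : ∀ v → lookup (K′ v) h ≡ lookup (K v) h
    same-h v with lookup (K v) h in eq
    ... | true  = trans (sym (ori v h)) eq
    ... | false = eq
  ... | no i≢h = other
    where
    opposite : lookup (K (v ⊕ h)) i ≡ lookup (K (v ⊕ i ⊕ h)) i
    opposite = trans (ori (v ⊕ h) i) (cong (λ x → lookup (K x) i) (sym (⊕-commutes v i≢h)))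

    parallel : lookup (K v) h ≢ lookup (K (v ⊕ i)) h → lookup (K v) i ≡ lookup (K (v ⊕ h)) i
    parallel = parallel-edges {K = K} ori sep i≢h

    other : lookup (K′ v) i ≡ lookup (K′ (v ⊕ i)) i
    other with lookup (K v) h | lookup (K (v ⊕ i)) h | parallel
    ... | true  | true  | _   = opposite
    ... | true  | false | par = trans (sym (par λ ())) (ori v i)
    ... | false | true  | par = trans (par λ ()) opposite
    ... | false | false | _   = ori v i

  swap-one : {v w : Vertex k} → lookup (K v) h ≡ true → lookup (K w) h ≡ false →
             ∃ λ i → lookup v i ≢ lookup w i × lookup (K (v ⊕ h)) i ≡ lookup (K w) i
  swap-one {v} {w} up down
    with sep (v ⊕ h) w (λ { refl → contradiction (trans (sym up) (trans (ori v h) down)) λ () })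
  ... | i , differ , agree with i ≟ h
  ... | yes refl = contradiction (trans (sym up) (trans (ori v h) (trans agree down))) λ ()
  -- Away from `h`, `v ⊕ h` and `v` have the same coordinates.
  ... | no i≢h   = i , differ ∘ trans (lookup-⊕-≢ v i≢h) , agree

  swap-separating : Separating K′
  swap-separating v w v≢w with lookup (K v) h in kv | lookup (K w) h in kw
  ... | false | false = sep v w v≢w
  ... | true  | false = swap-one kv kw
  ... | false | true  = let (i , differ , agree) = swap-one kw kv in i , ≢-sym differ , sym agree
  -- Moving both vertices across `h` preserves the set of coordinates in which they differ.
  ... | true  | true
    with sep (v ⊕ h) (w ⊕ h)
           (λ eq → v≢w (trans (sym (⊕-involutive v h))
                              (trans (cong (_⊕ h) eq) (⊕-involutive w h))))
  ... | i , differ , agree = i , differ ∘ ⊕-agree v w , agree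

theorem18 : (k : ℕ) (K : CubeMap k) (h : Fin k) → IsUSO K →
    IsOrientation (partialSwap K h) × IsUSO (partialSwap K h)
theorem18 k K h uso@(ori , _) =
  swapped-ori ,
  hasUniqueSinks⇒isUSO swapped-ori (separating⇒hasUniqueSinks {O = partialSwap K h} swapped-sep)
  where
  sep : Separating K
  sep = hasUniqueSinks⇒separating {O = K} (isUSO⇒hasUniqueSinks uso)

  swapped-ori : IsOrientation (partialSwap K h)
  swapped-ori v i
    rewrite partialSwap-if {K = K} ori h v | partialSwap-if {K = K} ori h (v ⊕ i) =
    swap-isOrientation {K = K} ori sep h v i

  swapped-sep : Separating (partialSwap K h)
  swapped-sep v w v≢w
    rewrite partialSwap-if {K = K} ori h v | partialSwap-if {K = K} ori h w =
    swap-separating {K = K} ori sep h v w v≢w
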